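{- The map $\Psi:\mathrm{CycPF}_n\to\mathrm{Comp}_n$ is a bijection. Moreover, for every $p\in\mathrm{CycPF}_n$ and every $j\in[n]$, the displacement of car $j$ in $p$ equals the inversion number $\mathrm{inv}_j(\mathrm{Perm}(\Psi(p)))$ of $j$ in the underlying permutation of $\Psi(p)$.
   Context: Classical parking process on $n$ spots for $p\in[n]^n$: cars $1,\dots,n$ enter in order; car $i$ parks in the first unoccupied spot $k\ge p_i$, failing if none. If all park, the outcome $\pi$ has $\pi_k$ = car in spot $k$, and the displacement vector is $\mathrm{disp}(p)=(d_1,\dots,d_n)$, $d_j=\pi^{ -1}_j-p_j$ (the displacement of car $j$). $\mathrm{Inc}_i^n:=i(i+1)\cdots n\,12\cdots(i-1)$; $\mathrm{CycPF}_n$ is the set of parking preferences for which all cars park and the outcome is $\mathrm{Inc}_i^n$ for some $i$. For a permutation $\sigma=\sigma_1\cdots\sigma_n\in S_n$, an inversion is a pair $(a,b)$ with $a>b$ and $a$ appearing before $b$; $\mathrm{inv}_a(\sigma)$ is the number of $b<a$ with $(a,b)$ an inversion, and $\mathrm{InvSeq}(\sigma)=(\mathrm{inv}_1(\sigma),\dots,\mathrm{inv}_n(\sigma))$; $\mathrm{InvSeq}$ is a bijection from $S_n$ onto sequences $(a_1,\dots,a_n)$ with $0\le a_k<k$. A component of $\sigma$ is a contiguous block $\sigma_a\cdots\sigma_b$ with $\{\sigma_a,\dots,\sigma_b\}=\{a,\dots,b\}$, minimal for inclusion; every permutation decomposes uniquely into components, and $\mathrm{comp}(\sigma)$ is its set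 of components. $\mathrm{Comp}_n:=\bigsqcup_{\sigma\in S_n}\mathrm{comp}(\sigma)$ (disjoint union, i.e. pairs (permutation, one of its components)); for $c\in\mathrm{Comp}_n$, $\mathrm{Perm}(c)$ is the underlying permutation. $\Psi(p)$, for $p$ with outcome $\mathrm{Inc}_i^n$, is the component containing $i$ of the unique $\sigma\in S_n$ with $\mathrm{InvSeq}(\sigma)=\mathrm{disp}(p)$ (so $\mathrm{Perm}(\Psi(p))=\sigma$).
   Formalization: A component σ_a⋯σ_b must also be preceded by exactly the letters 1,…,a−1 (the usual direct-sum components); under the literal definition 321 has no component containing 1, so Ψ(1,1,1) would be undefined. -}

module Defs where

open import Data.Bool.Base using (if_then_else_)
open import Data.Fin.Base using (Fin; zero; suc; toℕ; fromℕ; fromℕ<; punchIn; punchOut)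
  renaming (_≤_ to _≤ᶠ_; _<_ to _<ᶠ_)
open import Data.Fin.Permutation
  using (Permutation′; _⟨$⟩ʳ_; _⟨$⟩ˡ_; _≈_; inverseˡ; inverseʳ; insert; remove;
         insert-punchIn; insert-remove)
import Data.Fin.Permutation as Perm
import Data.Fin.Properties as Fin
open import Data.List.Base as List using (List; []; _∷_; _++_; allFin; filter; length)
open import Data.List.Membership.Propositional using (_∈_)
open import Data.List.Membership.Propositional.Properties using (∈-allFin)
open import Data.List.Relation.Unary.All as All using (All; []; _∷_)
open import Data.List.Relation.Unary.AllPairs using (AllPairs; []; _∷_)
open import Data.List.Relation.Unary.AllPairs.Properties using (tabulate⁺-<)
open import Data.List.Relation.Unary.Any using (here; there)
open import Data.Maybe.Base using (Maybe; just; nothing; _>>=_)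
open import Data.Maybe.Properties using (≡-dec; just-injective)
open import Data.Nat.Base
  using (ℕ; zero; suc; _+_; _∸_; _≤_; _<_; z≤n; s≤s; s≤s⁻¹)
import Data.Nat.Properties as ℕ
open import Data.Product.Base using (∃; _×_; _,_; proj₁; proj₂)
open import Data.Product using (∃!)
open import Data.Sum.Base using (inj₁; inj₂)
open import Data.Vec.Base as Vec using (Vec; lookup; _[_]≔_)
import Data.Vec.Properties as Vec
open import Data.Vec.Functional using (removeAt)
open import Algebra.Properties.CommutativeMonoid.Sum ℕ.+-0-commutativeMonoid
  using (sum; sum-remove; sum-permute; sum-cong-≗)
open import Function.Base using (_∘_; id)
open import Level using (0ℓ)
open import Relation.Binary.Core using (Rel)
open import Relation.Binary.PropositionalEquality
  using (_≡_; _≢_; _≗_; refl; sym; trans; cong; cong₂; subst; subst₂; module ≡-Reasoning)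
open import Relation.Nullary
  using (¬_; Dec; yes; no; does; contradiction; _×-dec_; _→-dec_)
open import Relation.Unary using (Pred; Decidable; _≐_; _⊆_)

private variable
  n : ℕ

------------------------------------------------------------------------
-- The parking process

-- Cars, spots and letters are numbered from 0, so that [n] is Fin n.

-- The cars currently parked, spot by spot.
Street : ℕ → Set
Street n = Vec (Maybe (Fin n)) n

free? : (s : Street n) → Decidable (λ k → lookup s k ≡ nothing)
free? s k = ≡-dec Fin._≟_ (lookup s k) nothing

-- allFin lists the spots in increasing order.
firstFree : Street n → Fin n → Maybe (Fin n)
firstFree {n} s q =
  List.head (filter (λ k → (q Fin.≤? k) ×-dec free? s k) (allFin n))

parkAll : Vec (Fin n) n → List (Fin n) → Street n → Maybe (Street n)
parkAll p []       s = just s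
parkAll p (j ∷ js) s =
  firstFree s (lookup p j) >>= λ k → parkAll p js (s [ k ]≔ just j)

park : Vec (Fin n) n → Maybe (Street n)
park {n} p = parkAll p (allFin n) (Vec.replicate n nothing)

-- The outcome π has π ⟨$⟩ʳ k = car in spot k and π ⟨$⟩ˡ j = spot of car j.
record ParkingFunction (n : ℕ) : Set where
  field
    pref    : Vec (Fin n) n
    outcome : Permutation′ n
    parks   : park pref ≡ just (Vec.tabulate (λ k → just (outcome ⟨$⟩ʳ k)))

-- Truncated subtraction loses nothing: a car never parks before its
-- preferred spot (see spotOf below).
displacement : ParkingFunction n → Fin n → ℕ
displacement P j = toℕ (outcome ⟨$⟩ˡ j) ∸ toℕ (lookup pref j)
  where open ParkingFunction P

word : Permutation′ n → List (Fin n)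
word σ = List.tabulate (σ ⟨$⟩ʳ_)

Inc : Fin n → List (Fin n)
Inc {n} i = List.drop (toℕ i) (allFin n) ++ List.take (toℕ i) (allFin n)

record CycPF (n : ℕ) : Set where
  field
    parking : ParkingFunction n
    start   : Fin n
    cyclic  : word (ParkingFunction.outcome parking) ≡ Inc start
  open ParkingFunction parking public

-- CycPF n is a set of preferences; the other fields are determined by pref.
_≈ᶜ_ : Rel (CycPF n) 0ℓ
p ≈ᶜ q = CycPF.pref p ≡ CycPF.pref q

disp : CycPF n → Fin n → ℕ
disp p = displacement (CycPF.parking p)

------------------------------------------------------------------------
-- Inversions

-- Letter a appears before letter b in the word of σ.
Before : Permutation′ n → Rel (Fin n) 0ℓ
Before σ a b = (σ ⟨$⟩ˡ a) <ᶠ (σ ⟨$⟩ˡ b)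

Inversion : Permutation′ n → Rel (Fin n) 0ℓ
Inversion σ a b = b <ᶠ a × Before σ a b

inversion? : (σ : Permutation′ n) (a : Fin n) → Decidable (Inversion σ a)
inversion? σ a b = (b Fin.<? a) ×-dec ((σ ⟨$⟩ˡ a) Fin.<? (σ ⟨$⟩ˡ b))

inv : Fin n → Permutation′ n → ℕ
inv {n} a σ = length (filter (inversion? σ a) (allFin n))

InvSeq : Permutation′ n → Fin n → ℕ
InvSeq σ a = inv a σ

------------------------------------------------------------------------
-- Components

-- The pair (a , b) stands for the interval {a, …, b}.
Block : ℕ → Set
Block n = Fin n × Fin n

⟦_⟧ : Block n → Pred (Fin n) 0ℓ
⟦ a , b ⟧ k = a ≤ᶠ k × k ≤ᶠ b

Image : Permutation′ n → Pred (Fin n) 0ℓ → Pred (Fin n) 0ℓ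
Image σ S m = ∃ λ k → S k × σ ⟨$⟩ʳ k ≡ m

Preserves : Permutation′ n → Pred (Fin n) 0ℓ → Set
Preserves σ S = Image σ S ≐ S

-- A nonempty block σ_a ⋯ σ_b along which the word of σ can be cut: the
-- letters before it are {0, …, a-1} and its own letters are {a, …, b}, hence
-- those after it are {b+1, …, n-1}.  The first requirement is what makes
-- the minimal blocks a decomposition of σ: without it the fixed point in
-- the middle of 321 would be a minimal block, in conflict with 321 being
-- its own only component.
IsBlock : Permutation′ n → Block n → Set
IsBlock σ (a , b) =
  a ≤ᶠ b × Preserves σ (λ k → k <ᶠ a) × Preserves σ ⟦ a , b ⟧

IsComponent : Permutation′ n → Block n → Set
IsComponent σ B =
  IsBlock σ B × (∀ B′ → IsBlock σ B′ → ⟦ B′ ⟧ ⊆ ⟦ B ⟧ → ⟦ B ⟧ ⊆ ⟦ B′ ⟧)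

record Comp (n : ℕ) : Set where
  constructor mkComp
  field
    Perm        : Permutation′ n
    block       : Block n
    isComponent : IsComponent Perm block

open Comp public using (Perm)

_≈ᴷ_ : Rel (Comp n) 0ℓ
c ≈ᴷ d = (Perm c ≈ Perm d) × (Comp.block c ≡ Comp.block d)

------------------------------------------------------------------------
-- Displacements are bounded: displacement P j ≤ toℕ j

head-filter : {P : Pred (Fin n) 0ℓ} (P? : Decidable P) {xs : List (Fin n)} →
              AllPairs _<ᶠ_ xs → ∀ {k} → List.head (filter P? xs) ≡ just k →
              P k × (∀ {l} → l ∈ xs → l <ᶠ k → ¬ P l)
head-filter P? {[]} [] ()
head-filter P? {x ∷ xs} (x< ∷ sorted) {k} eq with P? x
head-filter P? {x ∷ xs} (x< ∷ sorted) refl | yes px = px , λ where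
  (here refl) l<k → contradiction l<k ℕ.1+n≰n
  (there l∈)  l<k → contradiction l<k (ℕ.<-asym (All.lookup x< l∈))
... | no ¬px with head-filter P? sorted eq
...   | pk , below = pk , λ where
  (here refl) _   → ¬px
  (there l∈)  l<k → below l∈ l<k

allFin-sorted : ∀ n → AllPairs _<ᶠ_ (allFin n)
allFin-sorted n = tabulate⁺-< id

firstFree-spec : (s : Street n) (q : Fin n) {k : Fin n} → firstFree s q ≡ just k →
                 q ≤ᶠ k × lookup s k ≡ nothing ×
                 (∀ l → q ≤ᶠ l → l <ᶠ k → lookup s l ≢ nothing)
firstFree-spec {n} s q eq
  with head-filter (λ k → (q Fin.≤? k) ×-dec free? s k) (allFin-sorted n) eq
... | (q≤k , k-free) , below =
  q≤k , k-free , λ l q≤l l<k l-free → below (∈-allFin l) l<k (q≤l , l-free)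

-- In the final street t, car j occupies spot k, and the spots it drove past
-- are occupied by earlier cars.
ParkedAt : Vec (Fin n) n → Street n → Fin n → Fin n → Set
ParkedAt p t j k =
  lookup t k ≡ just j × lookup p j ≤ᶠ k ×
  (∀ l → lookup p j ≤ᶠ l → l <ᶠ k → ∃ λ c → lookup t l ≡ just c × c <ᶠ j)

parkAll-spec : (p : Vec (Fin n) n) {js : List (Fin n)} (s : Street n) {t : Street n} →
               AllPairs _<ᶠ_ js →
               (∀ k {c} → lookup s k ≡ just c → All (c <ᶠ_) js) →
               parkAll p js s ≡ just t →
               (∀ k {c} → lookup s k ≡ just c → lookup t k ≡ just c) ×
               (∀ {j} → j ∈ js → ∃ (ParkedAt p t j))
parkAll-spec p {[]} s [] early refl = (λ k eq → eq) , λ ()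
parkAll-spec p {j ∷ js} s {t} (j< ∷ sorted) early eq
  with firstFree s (lookup p j) in found
... | just k
  with parkAll-spec p (s [ k ]≔ just j) sorted early′ eq
  where
  early′ : ∀ l {c} → lookup (s [ k ]≔ just j) l ≡ just c → All (c <ᶠ_) js
  early′ l eq with l Fin.≟ k
  ... | yes refl = subst (λ c → All (c <ᶠ_) js)
                     (just-injective (trans (sym (Vec.lookup∘updateAt k s)) eq)) j<
  ... | no l≢k   = All.tail (early l (trans (sym (Vec.lookup∘updateAt′ l k l≢k s)) eq))
... | kept , later = kept′ , parked
  where
  spec = firstFree-spec s (lookup p j) found

  kept′ : ∀ l {c} → lookup s l ≡ just c → lookup t l ≡ just c
  kept′ l eq with l Fin.≟ k
  ... | yes refl with () ← trans (sym (proj₁ (proj₂ spec))) eq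
  ... | no l≢k   = kept l (trans (Vec.lookup∘updateAt′ l k l≢k s) eq)

  passed : ∀ l → lookup p j ≤ᶠ l → l <ᶠ k → ∃ λ c → lookup t l ≡ just c × c <ᶠ j
  passed l q≤l l<k with lookup s l in taken
  ... | nothing = contradiction taken (proj₂ (proj₂ spec) l q≤l l<k)
  ... | just c  = c , kept′ l taken , All.head (early l taken)

  parked : ∀ {i} → i ∈ j ∷ js → ∃ (ParkedAt p t i)
  parked (here refl) = k , kept k (Vec.lookup∘updateAt k s) , proj₁ spec , passed
  parked (there i∈)  = later i∈

module _ (P : ParkingFunction n) where
  open ParkingFunction P

  spotOf : ∀ j → lookup pref j ≤ᶠ (outcome ⟨$⟩ˡ j) ×
                 (∀ l → lookup pref j ≤ᶠ l → l <ᶠ (outcome ⟨$⟩ˡ j) →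
                  (outcome ⟨$⟩ʳ l) <ᶠ j)
  spotOf j
    with proj₂ (parkAll-spec pref (Vec.replicate n nothing) (allFin-sorted n)
                  (λ k eq → contradiction (trans (sym eq) (Vec.lookup-replicate k nothing)) λ ())
                  parks)
               (∈-allFin j)
  ... | k , at-k , q≤k , passed = subst (lookup pref j ≤ᶠ_) k≡ q≤k , passed′
    where
    final : ∀ l {c} → lookup (Vec.tabulate (λ k → just (outcome ⟨$⟩ʳ k))) l ≡ just c →
            outcome ⟨$⟩ʳ l ≡ c
    final l eq = just-injective (trans (sym (Vec.lookup∘tabulate _ l)) eq)

    k≡ : k ≡ outcome ⟨$⟩ˡ j
    k≡ = trans (sym (inverseˡ outcome)) (cong (outcome ⟨$⟩ˡ_) (final k at-k))

    passed′ : ∀ l → lookup pref j ≤ᶠ l → l <ᶠ (outcome ⟨$⟩ˡ j) → (outcome ⟨$⟩ʳ l) <ᶠ j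
    passed′ l q≤l l< with passed l q≤l (subst (l <ᶠ_) (sym k≡) l<)
    ... | c , at-l , c<j = subst (_<ᶠ j) (sym (final l at-l)) c<j

  displacement-bounded : ∀ j → displacement P j ≤ toℕ j
  displacement-bounded j = Fin.injective⇒≤ {f = car} car-injective
    where
    q s : ℕ
    q = toℕ (lookup pref j)
    s = toℕ (outcome ⟨$⟩ˡ j)

    q+x<s : (x : Fin (s ∸ q)) → q + toℕ x < s
    q+x<s x = subst (q + toℕ x <_) (ℕ.m+[n∸m]≡n (proj₁ (spotOf j)))
                (ℕ.+-monoʳ-< q (Fin.toℕ<n x))

    spot : Fin (s ∸ q) → Fin n
    spot x = fromℕ< (ℕ.<-trans (q+x<s x) (Fin.toℕ<n (outcome ⟨$⟩ˡ j)))

    toℕ-spot : ∀ x → toℕ (spot x) ≡ q + toℕ x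
    toℕ-spot x = Fin.toℕ-fromℕ< _

    earlier : ∀ x → (outcome ⟨$⟩ʳ spot x) <ᶠ j
    earlier x = proj₂ (spotOf j) (spot x)
      (subst (q ≤_) (sym (toℕ-spot x)) (ℕ.m≤m+n q _))
      (subst (_< s) (sym (toℕ-spot x)) (q+x<s x))

    car : Fin (s ∸ q) → Fin (toℕ j)
    car x = fromℕ< (earlier x)

    car-injective : ∀ {x y} → car x ≡ car y → x ≡ y
    car-injective {x} {y} eq = Fin.toℕ-injective (ℕ.+-cancelˡ-≡ q _ _ (begin
      q + toℕ x     ≡⟨ sym (toℕ-spot x) ⟩
      toℕ (spot x)  ≡⟨ cong toℕ same-spot ⟩
      toℕ (spot y)  ≡⟨ toℕ-spot y ⟩
      q + toℕ y     ∎))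
      where
      open ≡-Reasoning
      same-car : outcome ⟨$⟩ʳ spot x ≡ outcome ⟨$⟩ʳ spot y
      same-car = Fin.toℕ-injective (trans (sym (Fin.toℕ-fromℕ< (earlier x)))
                   (trans (cong toℕ eq) (Fin.toℕ-fromℕ< (earlier y))))
      same-spot : spot x ≡ spot y
      same-spot = trans (sym (inverseˡ outcome))
                    (trans (cong (outcome ⟨$⟩ˡ_) same-car) (inverseˡ outcome))

------------------------------------------------------------------------
-- InvSeq is a bijection onto the sequences with d j ≤ toℕ j

[_] : {A : Set} → Dec A → ℕ
[ d ] = if does d then 1 else 0

[]-yes : {A : Set} (d : Dec A) → A → [ d ] ≡ 1
[]-yes (yes _) a = refl
[]-yes (no ¬a) a = contradiction a ¬a

[]-no : {A : Set} (d : Dec A) → ¬ A → [ d ] ≡ 0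
[]-no (yes a) ¬a = contradiction a ¬a
[]-no (no _)  ¬a = refl

[]-cong : {A B : Set} (d : Dec A) (e : Dec B) → (A → B) → (B → A) → [ d ] ≡ [ e ]
[]-cong (yes a) e f g = sym ([]-yes e (f a))
[]-cong (no ¬a) e f g = sym ([]-no e (¬a ∘ g))

length-filter-tabulate : ∀ {m} {A : Set} {P : Pred A 0ℓ} (P? : Decidable P) (f : Fin m → A) →
                         length (filter P? (List.tabulate f)) ≡ sum (λ i → [ P? (f i) ])
length-filter-tabulate {zero}  P? f = refl
length-filter-tabulate {suc m} P? f with P? (f zero)
... | yes _ = cong suc (length-filter-tabulate P? (f ∘ suc))
... | no  _ = length-filter-tabulate P? (f ∘ suc)

inv-sum : (a : Fin n) (σ : Permutation′ n) → inv a σ ≡ sum (λ b → [ inversion? σ a b ])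
inv-sum a σ = length-filter-tabulate (inversion? σ a) id

≈-from : {σ τ : Permutation′ n} → σ ≈ τ → ∀ a → σ ⟨$⟩ˡ a ≡ τ ⟨$⟩ˡ a
≈-from {σ = σ} {τ} σ≈τ a = begin
  σ ⟨$⟩ˡ a                    ≡⟨ sym (inverseˡ τ) ⟩
  τ ⟨$⟩ˡ (τ ⟨$⟩ʳ (σ ⟨$⟩ˡ a))  ≡⟨ cong (τ ⟨$⟩ˡ_) (sym (σ≈τ _)) ⟩
  τ ⟨$⟩ˡ (σ ⟨$⟩ʳ (σ ⟨$⟩ˡ a))  ≡⟨ cong (τ ⟨$⟩ˡ_) (inverseʳ σ) ⟩
  τ ⟨$⟩ˡ a                    ∎
  where open ≡-Reasoning

inv-cong : {σ τ : Permutation′ n} → σ ≈ τ → InvSeq σ ≗ InvSeq τ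
inv-cong {σ = σ} {τ} σ≈τ a = trans (inv-sum a σ) (trans (sum-cong-≗ λ b →
    []-cong (inversion? σ a b) (inversion? τ a b)
      (λ (lt , bef) → lt , subst₂ _<ᶠ_ (≈-from {σ = σ} {τ} σ≈τ a) (≈-from {σ = σ} {τ} σ≈τ b) bef)
      (λ (lt , bef) → lt , subst₂ _<ᶠ_ (sym (≈-from {σ = σ} {τ} σ≈τ a))
                                       (sym (≈-from {σ = σ} {τ} σ≈τ b)) bef))
  (sym (inv-sum a τ)))

punchIn-mono-< : (i : Fin (suc n)) {j k : Fin n} → j <ᶠ k → punchIn i j <ᶠ punchIn i k
punchIn-mono-< i {j} {k} j<k = ℕ.≰⇒> (λ le → ℕ.<⇒≱ j<k (Fin.punchIn-cancel-≤ i k j le))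

punchIn-cancel-< : (i : Fin (suc n)) {j k : Fin n} → punchIn i j <ᶠ punchIn i k → j <ᶠ k
punchIn-cancel-< i {j} {k} lt = ℕ.≰⇒> (λ le → ℕ.<⇒≱ lt (Fin.punchIn-mono-≤ i k j le))

toℕ-punchIn-fromℕ : (a : Fin n) → toℕ (punchIn (fromℕ n) a) ≡ toℕ a
toℕ-punchIn-fromℕ zero    = refl
toℕ-punchIn-fromℕ (suc a) = cong suc (toℕ-punchIn-fromℕ a)

punchIn-fromℕ< : (a : Fin n) → punchIn (fromℕ n) a <ᶠ fromℕ n
punchIn-fromℕ< {n} a =
  subst₂ _<_ (sym (toℕ-punchIn-fromℕ a)) (sym (Fin.toℕ-fromℕ n)) (Fin.toℕ<n a)

-- The number of k ∈ Fin n pushed past position p by an insertion at p.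
count-after : (p : Fin (suc n)) → sum {n} (λ k → [ p Fin.<? punchIn p k ]) ≡ n ∸ toℕ p
count-after {zero}  zero    = refl
count-after {suc n} zero    = cong suc (count-after {n} zero)
count-after {suc n} (suc p) = trans
  (sum-cong-≗ λ k → []-cong (suc p Fin.<? suc (punchIn p k)) (p Fin.<? punchIn p k) s≤s⁻¹ s≤s)
  (count-after p)

byLast : (Q : Fin (suc n) → Set) → Q (fromℕ n) → (∀ a → Q (punchIn (fromℕ n) a)) → ∀ a → Q a
byLast {n} Q last rest a with fromℕ n Fin.≟ a
... | yes refl = last
... | no  ≢a   = subst Q (Fin.punchIn-punchOut ≢a) (rest (punchOut ≢a))

module _ (p : Fin (suc n)) (σ : Permutation′ n) where
  private
    top = fromℕ n
    τ   = insert p top σ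

  insert-at : τ ⟨$⟩ʳ p ≡ top
  insert-at with p Fin.≟ p
  ... | yes _  = refl
  ... | no p≢p = contradiction refl p≢p

  from-top : τ ⟨$⟩ˡ top ≡ p
  from-top = trans (cong (τ ⟨$⟩ˡ_) (sym insert-at)) (inverseˡ τ)

  from-punchIn : ∀ b → τ ⟨$⟩ˡ punchIn top b ≡ punchIn p (σ ⟨$⟩ˡ b)
  from-punchIn b = begin
    τ ⟨$⟩ˡ punchIn top b                     ≡⟨ cong (λ c → τ ⟨$⟩ˡ punchIn top c) (sym (inverseʳ σ)) ⟩
    τ ⟨$⟩ˡ punchIn top (σ ⟨$⟩ʳ (σ ⟨$⟩ˡ b))   ≡⟨ cong (τ ⟨$⟩ˡ_) (sym (insert-punchIn p top σ _)) ⟩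
    τ ⟨$⟩ˡ (τ ⟨$⟩ʳ punchIn p (σ ⟨$⟩ˡ b))     ≡⟨ inverseˡ τ ⟩
    punchIn p (σ ⟨$⟩ˡ b)                     ∎
    where open ≡-Reasoning

  private
    -- The largest letter never is the smaller letter of an inversion.
    drop-top : ∀ a → inv a τ ≡ sum (λ b → [ inversion? τ a (punchIn top b) ])
    drop-top a = begin
      inv a τ
        ≡⟨ inv-sum a τ ⟩
      sum (λ b → [ inversion? τ a b ])
        ≡⟨ sum-remove {i = top} (λ b → [ inversion? τ a b ]) ⟩
      [ inversion? τ a top ] + sum (λ b → [ inversion? τ a (punchIn top b) ])
        ≡⟨ cong (_+ sum (λ b → [ inversion? τ a (punchIn top b) ]))
             ([]-no (inversion? τ a top) λ (top<a , _) → ℕ.<⇒≱ top<a (Fin.≤fromℕ a)) ⟩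
      sum (λ b → [ inversion? τ a (punchIn top b) ]) ∎
      where open ≡-Reasoning

  inv-insert-top : inv top τ ≡ n ∸ toℕ p
  inv-insert-top = begin
    inv top τ
      ≡⟨ drop-top top ⟩
    sum (λ b → [ inversion? τ top (punchIn top b) ])
      ≡⟨ sum-cong-≗ (λ b → []-cong (inversion? τ top (punchIn top b)) (p Fin.<? punchIn p (σ ⟨$⟩ˡ b))
           (λ (_ , bef) → subst₂ _<ᶠ_ from-top (from-punchIn b) bef)
           (λ bef → punchIn-fromℕ< b , subst₂ _<ᶠ_ (sym from-top) (sym (from-punchIn b)) bef)) ⟩
    sum (λ b → [ p Fin.<? punchIn p (σ ⟨$⟩ˡ b) ])
      ≡⟨ sym (sum-permute (λ k → [ p Fin.<? punchIn p k ]) (Perm.flip σ)) ⟩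
    sum (λ k → [ p Fin.<? punchIn p k ])
      ≡⟨ count-after p ⟩
    n ∸ toℕ p ∎
    where open ≡-Reasoning

  inv-insert-punchIn : ∀ a → inv (punchIn top a) τ ≡ inv a σ
  inv-insert-punchIn a = begin
    inv (punchIn top a) τ
      ≡⟨ drop-top (punchIn top a) ⟩
    sum (λ b → [ inversion? τ (punchIn top a) (punchIn top b) ])
      ≡⟨ sum-cong-≗ (λ b → []-cong (inversion? τ (punchIn top a) (punchIn top b)) (inversion? σ a b)
           (λ (lt , bef) → punchIn-cancel-< top lt ,
              punchIn-cancel-< p (subst₂ _<ᶠ_ (from-punchIn a) (from-punchIn b) bef))
           (λ (lt , bef) → punchIn-mono-< top lt ,
              subst₂ _<ᶠ_ (sym (from-punchIn a)) (sym (from-punchIn b)) (punchIn-mono-< p bef))) ⟩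
    sum (λ b → [ inversion? σ a b ])
      ≡⟨ sym (inv-sum a σ) ⟩
    inv a σ ∎
    where open ≡-Reasoning

invSeq-onto : (d : Fin n → ℕ) → (∀ j → d j ≤ toℕ j) → ∃ λ σ → InvSeq σ ≗ d
invSeq-onto {zero}  d d≤ = Perm.id , λ ()
invSeq-onto {suc n} d d≤
  with invSeq-onto (d ∘ punchIn (fromℕ n))
         (λ j → subst (d (punchIn (fromℕ n) j) ≤_) (toℕ-punchIn-fromℕ j) (d≤ _))
... | σ , σ-ok = insert p (fromℕ n) σ , byLast _ top-ok rest-ok
  where
  p< : n ∸ d (fromℕ n) < suc n
  p< = s≤s (ℕ.m∸n≤m n (d (fromℕ n)))

  p : Fin (suc n)
  p = fromℕ< p<

  top-ok : inv (fromℕ n) (insert p (fromℕ n) σ) ≡ d (fromℕ n)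
  top-ok = trans (inv-insert-top p σ) (trans (cong (n ∸_) (Fin.toℕ-fromℕ< p<))
    (ℕ.m∸[m∸n]≡n (subst (d (fromℕ n) ≤_) (Fin.toℕ-fromℕ n) (d≤ (fromℕ n)))))

  rest-ok : ∀ a → inv (punchIn (fromℕ n) a) (insert p (fromℕ n) σ) ≡ d (punchIn (fromℕ n) a)
  rest-ok a = trans (inv-insert-punchIn p σ a) (σ-ok a)

-- Every permutation of Fin (suc n) arises by inserting the largest letter.
unInsert : (σ : Permutation′ (suc n)) →
           insert (σ ⟨$⟩ˡ fromℕ n) (fromℕ n) (remove (σ ⟨$⟩ˡ fromℕ n) σ) ≈ σ
unInsert {n} σ = subst (λ c → insert p c (remove p σ) ≈ σ) (inverseʳ σ) (insert-remove p σ)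
  where p = σ ⟨$⟩ˡ fromℕ n

invSeq-injective : (σ τ : Permutation′ n) → InvSeq σ ≗ InvSeq τ → σ ≈ τ
invSeq-injective {zero}  σ τ eq ()
invSeq-injective {suc n} σ τ eq k = begin
  σ ⟨$⟩ʳ k             ≡⟨ sym (unInsert σ k) ⟩
  insert p top σ′ ⟨$⟩ʳ k  ≡⟨ cong (λ r → insert r top σ′ ⟨$⟩ʳ k) p≡q ⟩
  insert q top σ′ ⟨$⟩ʳ k  ≡⟨ insert-cong ⟩
  insert q top τ′ ⟨$⟩ʳ k  ≡⟨ unInsert τ k ⟩
  τ ⟨$⟩ʳ k             ∎
  where
  open ≡-Reasoning
  top = fromℕ n
  p = σ ⟨$⟩ˡ top
  q = τ ⟨$⟩ˡ top
  σ′ = remove p σ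
  τ′ = remove q τ

  inserted : InvSeq (insert p top σ′) ≗ InvSeq (insert q top τ′)
  inserted a = trans (inv-cong {σ = insert p top σ′} {σ} (unInsert σ) a)
    (trans (eq a) (sym (inv-cong {σ = insert q top τ′} {τ} (unInsert τ) a)))

  p≡q : p ≡ q
  p≡q = Fin.toℕ-injective (ℕ.∸-cancelˡ-≡ (s≤s⁻¹ (Fin.toℕ<n p)) (s≤s⁻¹ (Fin.toℕ<n q))
    (trans (sym (inv-insert-top p σ′)) (trans (inserted top) (inv-insert-top q τ′))))

  σ′≈τ′ : σ′ ≈ τ′
  σ′≈τ′ = invSeq-injective σ′ τ′ λ a → trans (sym (inv-insert-punchIn p σ′ a))
    (trans (inserted (punchIn top a)) (inv-insert-punchIn q τ′ a))

  insert-cong : insert q top σ′ ⟨$⟩ʳ k ≡ insert q top τ′ ⟨$⟩ʳ k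
  insert-cong with q Fin.≟ k
  ... | yes _   = refl
  ... | no  q≢k = cong (punchIn top) (σ′≈τ′ (punchOut q≢k))

invSeq-bijective : (d : Fin n → ℕ) → (∀ j → d j ≤ toℕ j) → ∃! _≈_ (λ σ → InvSeq σ ≗ d)
invSeq-bijective d d≤ with invSeq-onto d d≤
... | σ , σ-ok = σ , σ-ok , λ {τ} τ-ok →
  invSeq-injective σ τ (λ a → trans (σ-ok a) (sym (τ-ok a)))

------------------------------------------------------------------------
-- Every letter lies in exactly one component

-- The word of σ can be cut after its first c letters.
Cut : Permutation′ n → ℕ → Set
Cut σ c = ∀ k → (toℕ k < c → toℕ (σ ⟨$⟩ʳ k) < c) × (toℕ (σ ⟨$⟩ʳ k) < c → toℕ k < c)

cut? : (σ : Permutation′ n) → Decidable (Cut σ)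
cut? σ c = Fin.all? λ k →
  ((toℕ k ℕ.<? c) →-dec (toℕ (σ ⟨$⟩ʳ k) ℕ.<? c)) ×-dec
  ((toℕ (σ ⟨$⟩ʳ k) ℕ.<? c) →-dec (toℕ k ℕ.<? c))

module _ (σ : Permutation′ n) where

  preserves⁻ : (S : Pred (Fin n) 0ℓ) → Preserves σ S →
               ∀ k → (S k → S (σ ⟨$⟩ʳ k)) × (S (σ ⟨$⟩ʳ k) → S k)
  preserves⁻ S (im⊆ , ⊆im) k = (λ sk → im⊆ (k , sk , refl)) , back
    where
    back : S (σ ⟨$⟩ʳ k) → S k
    back sσk with ⊆im sσk
    ... | l , sl , eq =
      subst S (trans (sym (inverseˡ σ)) (trans (cong (σ ⟨$⟩ˡ_) eq) (inverseˡ σ))) sl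

  preserves⁺ : (S : Pred (Fin n) 0ℓ) →
               (∀ k → (S k → S (σ ⟨$⟩ʳ k)) × (S (σ ⟨$⟩ʳ k) → S k)) → Preserves σ S
  preserves⁺ S h =
    (λ (k , sk , eq) → subst S eq (proj₁ (h k) sk)) ,
    (λ {m} sm → σ ⟨$⟩ˡ m , proj₂ (h _) (subst S (sym (inverseʳ σ)) sm) , inverseʳ σ)

  block⁻ : ∀ {a b} → IsBlock σ (a , b) → a ≤ᶠ b × Cut σ (toℕ a) × Cut σ (suc (toℕ b))
  block⁻ {a} {b} (a≤b , pre , mid) = a≤b , cut-a , λ k → fwd k , bwd k
    where
    cut-a = preserves⁻ (λ k → k <ᶠ a) pre
    in-ab = preserves⁻ ⟦ a , b ⟧ mid

    fwd : ∀ k → toℕ k < suc (toℕ b) → toℕ (σ ⟨$⟩ʳ k) < suc (toℕ b)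
    fwd k k≤b with k Fin.<? a
    ... | yes k<a = ℕ.≤-trans (proj₁ (cut-a k) k<a) (ℕ.m≤n⇒m≤1+n a≤b)
    ... | no  k≮a = s≤s (proj₂ (proj₁ (in-ab k) (ℕ.≮⇒≥ k≮a , s≤s⁻¹ k≤b)))

    bwd : ∀ k → toℕ (σ ⟨$⟩ʳ k) < suc (toℕ b) → toℕ k < suc (toℕ b)
    bwd k σk≤b with (σ ⟨$⟩ʳ k) Fin.<? a
    ... | yes σk<a = ℕ.≤-trans (proj₂ (cut-a k) σk<a) (ℕ.m≤n⇒m≤1+n a≤b)
    ... | no  σk≮a = s≤s (proj₂ (proj₂ (in-ab k) (ℕ.≮⇒≥ σk≮a , s≤s⁻¹ σk≤b)))

  block⁺ : ∀ {a b} → a ≤ᶠ b → Cut σ (toℕ a) → Cut σ (suc (toℕ b)) → IsBlock σ (a , b)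
  block⁺ {a} {b} a≤b cut-a cut-b =
    a≤b , preserves⁺ (λ k → k <ᶠ a) cut-a , preserves⁺ ⟦ a , b ⟧ λ k →
      (λ (a≤k , k≤b) → ℕ.≮⇒≥ (λ lt → ℕ.≤⇒≯ a≤k (proj₂ (cut-a k) lt)) ,
                        s≤s⁻¹ (proj₁ (cut-b k) (s≤s k≤b))) ,
      (λ (a≤σk , σk≤b) → ℕ.≮⇒≥ (λ lt → ℕ.≤⇒≯ a≤σk (proj₁ (cut-a k) lt)) ,
                          s≤s⁻¹ (proj₂ (cut-b k) (s≤s σk≤b)))

greatest : {P : Pred ℕ 0ℓ} → Decidable P → P 0 → ∀ i →
           ∃ λ c → c ≤ i × P c × (∀ {c′} → c′ ≤ i → P c′ → c′ ≤ c)
greatest P? p0 zero = 0 , z≤n , p0 , λ le _ → le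
greatest P? p0 (suc i) with P? (suc i)
... | yes pi = suc i , ℕ.≤-refl , pi , λ le _ → le
... | no ¬pi with greatest P? p0 i
...   | c , c≤i , pc , max = c , ℕ.m≤n⇒m≤1+n c≤i , pc , max′
  where
  max′ : ∀ {c′} → c′ ≤ suc i → _ → c′ ≤ c
  max′ le pc′ with ℕ.m≤n⇒m<n∨m≡n le
  ... | inj₁ lt   = max (s≤s⁻¹ lt) pc′
  ... | inj₂ refl = contradiction pc′ ¬pi

least : {P : Pred ℕ 0ℓ} → Decidable P → ∀ lo k → P (k + lo) →
        ∃ λ c → lo ≤ c × c ≤ k + lo × P c × (∀ {c′} → lo ≤ c′ → P c′ → c ≤ c′)
least P? lo k pk with P? lo
... | yes plo = lo , ℕ.≤-refl , ℕ.m≤n+m lo k , plo , λ le _ → le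
least P? lo zero    pk | no ¬plo = contradiction pk ¬plo
least {P} P? lo (suc k) pk | no ¬plo
  with least {P} P? (suc lo) k (subst P (sym (ℕ.+-suc k lo)) pk)
... | c , lo<c , c≤ , pc , min =
  c , ℕ.<⇒≤ lo<c , subst (c ≤_) (ℕ.+-suc k lo) c≤ , pc , min′
  where
  min′ : ∀ {c′} → lo ≤ c′ → P c′ → c ≤ c′
  min′ le pc′ with ℕ.m≤n⇒m<n∨m≡n le
  ... | inj₁ lt   = min lt pc′
  ... | inj₂ refl = contradiction pc′ ¬plo

componentOf : (σ : Permutation′ n) (i : Fin n) →
              ∃! _≡_ (λ B → IsComponent σ B × ⟦ B ⟧ i)
componentOf {n} σ i
  with greatest (cut? σ) (λ k → (λ ()) , (λ ())) (toℕ i)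
     | least {Cut σ} (cut? σ) (suc (toℕ i)) (n ∸ suc (toℕ i))
         (subst (Cut σ) (sym (ℕ.m∸n+n≡m (Fin.toℕ<n i)))
           (λ k → (λ _ → Fin.toℕ<n _) , (λ _ → Fin.toℕ<n k)))
... | a₀ , a≤i , cut-a , max | suc b₀ , i<b , b<n , cut-b , min =
  (a , b) , ((block , minimal) , i∈) , unique
  where
  b₀<n : b₀ < n
  b₀<n = subst (suc b₀ ≤_) (ℕ.m∸n+n≡m (Fin.toℕ<n i)) b<n

  a₀<n : a₀ < n
  a₀<n = ℕ.≤-<-trans a≤i (Fin.toℕ<n i)

  a b : Fin n
  a = fromℕ< a₀<n
  b = fromℕ< b₀<n

  a≡ : toℕ a ≡ a₀
  a≡ = Fin.toℕ-fromℕ< a₀<n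

  b≡ : toℕ b ≡ b₀
  b≡ = Fin.toℕ-fromℕ< b₀<n

  i∈ : ⟦ a , b ⟧ i
  i∈ = subst (_≤ toℕ i) (sym a≡) a≤i , subst (toℕ i ≤_) (sym b≡) (s≤s⁻¹ i<b)

  block : IsBlock σ (a , b)
  block = block⁺ σ (ℕ.≤-trans (proj₁ i∈) (proj₂ i∈))
    (subst (Cut σ) (sym a≡) cut-a) (subst (Cut σ ∘ suc) (sym b≡) cut-b)

  max-a : ∀ {c} → c ≤ toℕ i → Cut σ c → c ≤ toℕ a
  max-a le cut = subst (_ ≤_) (sym a≡) (max le cut)

  min-b : ∀ {c} → toℕ i < c → Cut σ c → toℕ b < c
  min-b lt cut = subst (_< _) (sym b≡) (min lt cut)

  minimal : ∀ B′ → IsBlock σ B′ → ⟦ B′ ⟧ ⊆ ⟦ a , b ⟧ → ⟦ a , b ⟧ ⊆ ⟦ B′ ⟧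
  minimal (a′ , b′) block′ B′⊆B (a≤k , k≤b) with block⁻ σ block′
  ... | a′≤b′ , cut-a′ , cut-b′ = ℕ.≤-trans a′≤a a≤k , ℕ.≤-trans k≤b b≤b′
    where
    a′∈ : ⟦ a , b ⟧ a′
    a′∈ = B′⊆B (ℕ.≤-refl , a′≤b′)
    a′≤a : a′ ≤ᶠ a
    a′≤a = max-a (ℕ.≮⇒≥ λ i<a′ → ℕ.<⇒≱ (min-b i<a′ cut-a′) (proj₂ a′∈)) cut-a′
    b≤b′ : b ≤ᶠ b′
    b≤b′ = s≤s⁻¹ (min-b (ℕ.≰⇒> λ b′<i →
      ℕ.<⇒≱ (ℕ.≤-trans (max-a b′<i cut-b′) (proj₁ a′∈)) a′≤b′) cut-b′)

  unique : ∀ {B′} → IsComponent σ B′ × ⟦ B′ ⟧ i → (a , b) ≡ B′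
  unique {a′ , b′} ((block′ , minimal′) , a′≤i , i≤b′) with block⁻ σ block′
  ... | a′≤b′ , cut-a′ , cut-b′ = cong₂ _,_
      (Fin.toℕ-injective (ℕ.≤-antisym (proj₁ (B′⊆B (ℕ.≤-refl , a′≤b′))) a′≤a))
      (Fin.toℕ-injective (ℕ.≤-antisym b≤b′ (proj₂ (B′⊆B (a′≤b′ , ℕ.≤-refl)))))
    where
    a′≤a : a′ ≤ᶠ a
    a′≤a = max-a a′≤i cut-a′
    b≤b′ : b ≤ᶠ b′
    b≤b′ = s≤s⁻¹ (min-b (s≤s i≤b′) cut-b′)
    B′⊆B : ⟦ a′ , b′ ⟧ ⊆ ⟦ a , b ⟧
    B′⊆B = minimal′ (a , b) block λ (a≤k , k≤b) → ℕ.≤-trans a′≤a a≤k , ℕ.≤-trans k≤b b≤b′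

------------------------------------------------------------------------
-- The map Ψ

Ψ : CycPF n → Comp n
Ψ p =
  let (σ , _ , _)           = invSeq-bijective (disp p) (displacement-bounded (CycPF.parking p))
      (B , (isComp , _) , _) = componentOf σ (CycPF.start p)
  in mkComp σ B isComp

{-# OPTIONS --safe #-}

-- A preference p with outcome Inc i amounts to a sequence d = disp p with d j ≤ j for all j and
-- d j ≤ j − i for all j ≥ i: in Inc i the run of earlier cars directly before car j has length
-- j − i if j ≥ i and j otherwise.  For the permutation σ with inversion sequence d, the bound
-- inv j σ ≤ j − i says that at least i smaller letters precede j.  It holds for every j ≥ i iff
-- the first i letters of σ are 0, …, i−1, that is, iff i is the lower end of a component of σ.
-- Hence Ψ p determines i and d, and every lower end of a component arises.
module Submission where

open import Data.Fin.Base using (Fin; zero; suc; toℕ; fromℕ<; inject≤)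
  renaming (_≤_ to _≤ᶠ_; _<_ to _<ᶠ_)
open import Data.Fin.Permutation
  using (Permutation′; permutation; flip; _⟨$⟩ʳ_; _⟨$⟩ˡ_; _≈_; inverseˡ; inverseʳ)
import Data.Fin.Properties as Fin
open import Data.List.Base as List using (List; []; _∷_; _++_; allFin; filter; applyUpTo; upTo)
open import Data.List.Membership.Propositional using (_∈_)
open import Data.List.Membership.Propositional.Properties using (∈-allFin)
import Data.List.Properties as List
open import Data.List.Relation.Unary.All as All using (All; []; _∷_)
open import Data.List.Relation.Unary.AllPairs using (AllPairs; []; _∷_)
open import Data.List.Relation.Unary.Any using (here; there)
open import Data.Maybe.Base using (just; nothing; _>>=_)
open import Data.Maybe.Properties using (just-injective)
open import Data.Nat.Base
  using (ℕ; zero; suc; _+_; _∸_; _≤_; _<_; z≤n; s≤s; s≤s⁻¹; NonZero)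
open import Data.Nat.DivMod
import Data.Nat.Properties as ℕ
open import Data.Product.Base using (_×_; _,_; proj₁; proj₂)
open import Data.Sum.Base using (_⊎_; inj₁; inj₂)
open import Data.Vec.Base as Vec using (Vec; lookup; _[_]≔_)
import Data.Vec.Properties as Vec
open import Algebra.Properties.CommutativeMonoid.Sum ℕ.+-0-commutativeMonoid
  using (sum; ∑-distrib-+; sum-permute; sum-cong-≗)
open import Function.Base using (_∘_; id)
open import Function.Definitions using (Injective)
open import Function.Structures using (IsBijection)
open import Level using (0ℓ)
open import Relation.Binary.Definitions using (tri<; tri≈; tri>)
open import Relation.Binary.PropositionalEquality
  using (_≡_; _≗_; refl; sym; trans; cong; cong₂; subst; module ≡-Reasoning)
open import Relation.Nullary using (¬_; Dec; yes; no; contradiction; _×-dec_)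
open import Relation.Unary using (Pred; Decidable)
open import Defs

private variable
  n : ℕ

-- Inversion numbers and cuts

sum-mono-≤ : {f g : Fin n → ℕ} → (∀ k → f k ≤ g k) → sum f ≤ sum g
sum-mono-≤ {zero}  f≤g = z≤n
sum-mono-≤ {suc n} f≤g = ℕ.+-mono-≤ (f≤g zero) (sum-mono-≤ (f≤g ∘ suc))

count-below : ∀ n {c} → c ≤ n → sum {n} (λ k → [ toℕ k ℕ.<? c ]) ≡ c
count-below zero    {zero}  _   = refl
count-below (suc n) {zero}  _   = trans
  (sum-cong-≗ {n} λ k → []-cong (suc (toℕ k) ℕ.<? 0) (toℕ k ℕ.<? 0) (λ ()) (λ ()))
  (count-below n z≤n)
count-below (suc n) {suc c} c≤n = cong suc (trans
  (sum-cong-≗ {n} λ k → []-cong (suc (toℕ k) ℕ.<? suc c) (toℕ k ℕ.<? c) s≤s⁻¹ s≤s)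
  (count-below n (s≤s⁻¹ c≤n)))

-- Summed over all letters, this bounds the total size of two disjoint subsets by the size of a set
-- containing both; `[]-cover` is the bound for a union in the other direction.
[]-disjoint : {A B C : Set} (a : Dec A) (b : Dec B) (c : Dec C) →
              (A → ¬ B) → (A → C) → (B → C) → [ a ] + [ b ] ≤ [ c ]
[]-disjoint (yes a) (yes b) c        dis f g = contradiction b (dis a)
[]-disjoint (yes a) (no _)  c        dis f g = ℕ.≤-reflexive (sym ([]-yes c (f a)))
[]-disjoint (no _)  (yes b) c        dis f g = ℕ.≤-reflexive (sym ([]-yes c (g b)))
[]-disjoint (no _)  (no _)  c        dis f g = z≤n

[]-cover : {A B C : Set} (a : Dec A) (b : Dec B) (c : Dec C) →
           (C → A ⊎ B) → [ c ] ≤ [ a ] + [ b ]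
[]-cover a b (no _)  f = z≤n
[]-cover a b (yes c) f with f c
... | inj₁ x = subst (λ y → 1 ≤ y + [ b ]) (sym ([]-yes a x)) (ℕ.m≤m+n 1 [ b ])
... | inj₂ x = subst (λ y → 1 ≤ [ a ] + y) (sym ([]-yes b x)) (ℕ.m≤n+m 1 [ a ])

-- Pigeonhole: if c ≤ k and f k < c, then k together with 0, ..., c-1 would be c+1 elements sent
-- injectively below c. In `g`, `zero` stands for k and `suc x` for x.
injective-below : (f : Fin n → Fin n) → Injective _≡_ _≡_ f → ∀ c →
                  (∀ k → toℕ k < c → toℕ (f k) < c) → ∀ k → toℕ (f k) < c → toℕ k < c
injective-below {n} f f-inj c f< k fk<c =
  ℕ.≰⇒> λ c≤k → Fin.<⇒notInjective {f = g c≤k} (ℕ.n<1+n c) (g-inj c≤k)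
  where
  module _ (c≤k : c ≤ toℕ k) where
    c≤n : c ≤ n
    c≤n = ℕ.≤-trans c≤k (ℕ.<⇒≤ (Fin.toℕ<n k))

    low : Fin c → Fin n
    low x = inject≤ x c≤n

    low< : ∀ x → toℕ (low x) < c
    low< x = subst (_< c) (sym (Fin.toℕ-inject≤ x c≤n)) (Fin.toℕ<n x)

    g : Fin (suc c) → Fin c
    g zero    = fromℕ< fk<c
    g (suc x) = fromℕ< (f< (low x) (low< x))

    g-inj : Injective _≡_ _≡_ g
    g-inj {zero}  {zero}  eq = refl
    g-inj {zero}  {suc y} eq = contradiction
      (f-inj (Fin.toℕ-injective (Fin.fromℕ<-injective _ _ fk<c (f< _ (low< y)) eq)))
      λ k≡ → ℕ.≤⇒≯ c≤k (subst (λ x → toℕ x < c) (sym k≡) (low< y))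
    g-inj {suc x} {zero}  eq = contradiction
      (f-inj (Fin.toℕ-injective (Fin.fromℕ<-injective _ _ (f< _ (low< x)) fk<c eq)))
      λ ≡k → ℕ.≤⇒≯ c≤k (subst (λ x → toℕ x < c) ≡k (low< x))
    g-inj {suc x} {suc y} eq = cong suc (Fin.inject≤-injective c≤n c≤n x y
      (f-inj (Fin.toℕ-injective (Fin.fromℕ<-injective _ _ (f< _ (low< x)) (f< _ (low< y)) eq))))

module _ (σ : Permutation′ n) where

  -- Each of the letters smaller than j either follows j, forming an inversion with it, or occupies
  -- one of the spots before j.
  inv+spot : ∀ j → toℕ j ≤ inv j σ + toℕ (σ ⟨$⟩ˡ j)
  inv+spot j = begin
    toℕ j
      ≡⟨ count-below n (ℕ.<⇒≤ (Fin.toℕ<n j)) ⟨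
    sum {n} (λ b → [ b Fin.<? j ])
      ≤⟨ sum-mono-≤ {n} (λ b → []-cover (inversion? σ j b) ((σ ⟨$⟩ˡ b) Fin.<? s) (b Fin.<? j) (side b)) ⟩
    sum (λ b → [ inversion? σ j b ] + [ (σ ⟨$⟩ˡ b) Fin.<? s ])
      ≡⟨ ∑-distrib-+ (λ b → [ inversion? σ j b ]) (λ b → [ (σ ⟨$⟩ˡ b) Fin.<? s ]) ⟩
    sum (λ b → [ inversion? σ j b ]) + sum (λ b → [ (σ ⟨$⟩ˡ b) Fin.<? s ])
      -- Reindexing along σ turns the count of letters standing before spot s into a count of spots.
      ≡⟨ cong₂ _+_ (inv-sum j σ) (sum-permute {n} {n} (λ k → [ k Fin.<? s ]) (flip σ)) ⟨
    inv j σ + sum {n} (λ k → [ k Fin.<? s ])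
      ≡⟨ cong (inv j σ +_) (count-below n (ℕ.<⇒≤ (Fin.toℕ<n s))) ⟩
    inv j σ + toℕ s ∎
    where
    open ℕ.≤-Reasoning
    s = σ ⟨$⟩ˡ j
    side : ∀ b → b <ᶠ j → Inversion σ j b ⊎ (σ ⟨$⟩ˡ b) <ᶠ s
    side b b<j with ℕ.<-cmp (toℕ (σ ⟨$⟩ˡ b)) (toℕ s)
    ... | tri< lt _ _ = inj₂ lt
    ... | tri> _ _ gt = inj₁ (b<j , gt)
    ... | tri≈ _ eq _ = contradiction
      (trans (sym (inverseʳ σ)) (trans (cong (σ ⟨$⟩ʳ_) (Fin.toℕ-injective eq)) (inverseʳ σ)))
      (Fin.<⇒≢ b<j)

  -- A letter j ≥ c in a spot k < c would give j ≤ inv j + k < (j - c) + c = j. So the first c spots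
  -- hold only letters below c, and by pigeonhole all of them.
  inv≤⇒cut : ∀ c → (∀ j → c ≤ toℕ j → inv j σ ≤ toℕ j ∸ c) → Cut σ c
  inv≤⇒cut c inv≤ k = fwd k , injective-below (σ ⟨$⟩ʳ_) σ-inj c fwd k
    where
    σ-inj : Injective _≡_ _≡_ (σ ⟨$⟩ʳ_)
    σ-inj eq = trans (sym (inverseˡ σ)) (trans (cong (σ ⟨$⟩ˡ_) eq) (inverseˡ σ))

    fwd : ∀ k → toℕ k < c → toℕ (σ ⟨$⟩ʳ k) < c
    fwd k k<c = ℕ.≰⇒> λ c≤j → ℕ.<-irrefl refl (begin-strict
      toℕ j                       ≤⟨ inv+spot j ⟩
      inv j σ + toℕ (σ ⟨$⟩ˡ j)    ≡⟨ cong (λ l → inv j σ + toℕ l) (inverseˡ σ) ⟩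
      inv j σ + toℕ k             ≤⟨ ℕ.+-monoˡ-≤ (toℕ k) (inv≤ j c≤j) ⟩
      toℕ j ∸ c + toℕ k           <⟨ ℕ.+-monoʳ-< (toℕ j ∸ c) k<c ⟩
      toℕ j ∸ c + c               ≡⟨ ℕ.m∸n+n≡m c≤j ⟩
      toℕ j                       ∎)
      where
      open ℕ.≤-Reasoning
      j = σ ⟨$⟩ʳ k

  -- The c letters below the cut all stand before j. They are smaller than j and disjoint from the
  -- letters that form an inversion with j.
  cut⇒inv≤ : ∀ {c} → Cut σ c → ∀ j → c ≤ toℕ j → inv j σ ≤ toℕ j ∸ c
  cut⇒inv≤ {c} cut j c≤j = ℕ.m+n≤o⇒m≤o∸n (inv j σ) (begin
    inv j σ + c
      ≡⟨ cong₂ _+_ (inv-sum j σ) (sym (count-below n (ℕ.≤-trans c≤j (ℕ.<⇒≤ (Fin.toℕ<n j))))) ⟩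
    sum (λ b → [ inversion? σ j b ]) + sum {n} (λ b → [ toℕ b ℕ.<? c ])
      ≡⟨ ∑-distrib-+ (λ b → [ inversion? σ j b ]) (λ b → [ toℕ b ℕ.<? c ]) ⟨
    sum (λ b → [ inversion? σ j b ] + [ toℕ b ℕ.<? c ])
      ≤⟨ sum-mono-≤ {n} (λ b → []-disjoint (inversion? σ j b) (toℕ b ℕ.<? c) (b Fin.<? j)
           (λ (_ , j-b) b<c → ℕ.≤⇒≯ c≤j (letter-low (ℕ.<-trans j-b (spot-low b<c))))
           proj₁ (λ b<c → ℕ.<-≤-trans b<c c≤j)) ⟩
    sum {n} (λ b → [ b Fin.<? j ])
      ≡⟨ count-below n (ℕ.<⇒≤ (Fin.toℕ<n j)) ⟩
    toℕ j ∎)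
    where
    open ℕ.≤-Reasoning
    spot-low : ∀ {b} → toℕ b < c → toℕ (σ ⟨$⟩ˡ b) < c
    spot-low b<c = proj₂ (cut _) (subst (λ b → toℕ b < c) (sym (inverseʳ σ)) b<c)
    letter-low : ∀ {b} → toℕ (σ ⟨$⟩ˡ b) < c → toℕ b < c
    letter-low lt = subst (λ b → toℕ b < c) (inverseʳ σ) (proj₁ (cut _) lt)

  inv≤ : ∀ j → inv j σ ≤ toℕ j
  -- Every permutation can be cut at 0.
  inv≤ j = cut⇒inv≤ (λ k → (λ ()) , (λ ())) j z≤n

  -- A cut at i inside the component makes (i , b) a block contained in it, so minimality leaves no
  -- room between a and i.
  component-start : ∀ {a b i} → IsComponent σ (a , b) → ⟦ a , b ⟧ i → Cut σ (toℕ i) → a ≡ i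
  component-start {a} {b} {i} (block , minimal) (a≤i , i≤b) cut-i with block⁻ σ block
  ... | a≤b , _ , cut-b = Fin.toℕ-injective (ℕ.≤-antisym a≤i (proj₁
    (minimal (i , b) (block⁺ σ i≤b cut-i cut-b) (λ (i≤k , k≤b) → ℕ.≤-trans a≤i i≤k , k≤b)
      (ℕ.≤-refl , a≤b))))

-- Invariance of components under pointwise equality

≈-sym : {σ τ : Permutation′ n} → σ ≈ τ → τ ≈ σ
≈-sym σ≈τ k = sym (σ≈τ k)

≈-trans : {σ τ υ : Permutation′ n} → σ ≈ τ → τ ≈ υ → σ ≈ υ
≈-trans σ≈τ τ≈υ k = trans (σ≈τ k) (τ≈υ k)

cut-cong : {σ τ : Permutation′ n} → σ ≈ τ → ∀ {c} → Cut σ c → Cut τ c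
cut-cong σ≈τ {c} cut k = subst (λ m → (toℕ k < c → toℕ m < c) × (toℕ m < c → toℕ k < c)) (σ≈τ k) (cut k)

isBlock-cong : {σ τ : Permutation′ n} → σ ≈ τ → ∀ {B} → IsBlock σ B → IsBlock τ B
isBlock-cong {σ = σ} {τ} σ≈τ block with block⁻ σ block
... | a≤b , cut-a , cut-b =
  block⁺ τ a≤b (cut-cong {σ = σ} {τ} σ≈τ cut-a) (cut-cong {σ = σ} {τ} σ≈τ cut-b)

isComponent-cong : {σ τ : Permutation′ n} → σ ≈ τ → ∀ {B} → IsComponent σ B → IsComponent τ B
isComponent-cong {σ = σ} {τ} σ≈τ (block , minimal) =
  isBlock-cong {σ = σ} {τ} σ≈τ block ,
  λ B′ block′ → minimal B′ (isBlock-cong {σ = τ} {σ} (≈-sym {σ = σ} {τ} σ≈τ) block′)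

-- Rotations

tabulate-injective : {A : Set} {f g : Fin n → A} → List.tabulate f ≡ List.tabulate g → f ≗ g
tabulate-injective eq zero    = proj₁ (List.∷-injective eq)
tabulate-injective eq (suc k) = tabulate-injective (proj₂ (List.∷-injective eq)) k

tabulate-toℕ : {A : Set} (f : ℕ → A) → ∀ n → List.tabulate {n = n} (f ∘ toℕ) ≡ applyUpTo f n
tabulate-toℕ f zero    = refl
tabulate-toℕ f (suc n) = cong (f 0 ∷_) (tabulate-toℕ (f ∘ suc) n)

applyUpTo-cong : {A : Set} {f g : ℕ → A} → ∀ n → (∀ {k} → k < n → f k ≡ g k) →
                 applyUpTo f n ≡ applyUpTo g n
applyUpTo-cong zero    eq = refl
applyUpTo-cong (suc n) eq = cong₂ _∷_ (eq (s≤s z≤n)) (applyUpTo-cong n (eq ∘ s≤s))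

applyUpTo-+ : {A : Set} (f : ℕ → A) → ∀ m n →
              applyUpTo f (m + n) ≡ applyUpTo f m ++ applyUpTo (f ∘ (m +_)) n
applyUpTo-+ f zero    n = refl
applyUpTo-+ f (suc m) n = cong (f 0 ∷_) (applyUpTo-+ (f ∘ suc) m n)

take-applyUpTo : {A : Set} (f : ℕ → A) → ∀ m n →
                 List.take m (applyUpTo f (m + n)) ≡ applyUpTo f m
take-applyUpTo f zero    n = refl
take-applyUpTo f (suc m) n = cong (f 0 ∷_) (take-applyUpTo (f ∘ suc) m n)

drop-applyUpTo : {A : Set} (f : ℕ → A) → ∀ m n →
                 List.drop m (applyUpTo f (m + n)) ≡ applyUpTo (f ∘ (m +_)) n
drop-applyUpTo f zero    n = refl
drop-applyUpTo f (suc m) n = drop-applyUpTo (f ∘ suc) m n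

[n+m]%n≡m : ∀ {m} .{{_ : NonZero n}} → m < n → (n + m) % n ≡ m
[n+m]%n≡m {n} {m} m<n =
  trans (cong (_% n) (ℕ.+-comm n m)) (trans ([m+n]%n≡m%n m n) (m<n⇒m%n≡m m<n))

[m+k%n]%n≡[m+k]%n : ∀ m k n .{{_ : NonZero n}} → (m + k % n) % n ≡ (m + k) % n
[m+k%n]%n≡[m+k]%n m k n = begin
  (m + k % n) % n          ≡⟨ %-distribˡ-+ m (k % n) n ⟩
  (m % n + k % n % n) % n  ≡⟨ cong (λ r → (m % n + r) % n) (m%n%n≡m%n k n) ⟩
  (m % n + k % n) % n      ≡⟨ %-distribˡ-+ m k n ⟨
  (m + k) % n              ∎
  where open ≡-Reasoning

module _ .{{_ : NonZero n}} where

  shift : ℕ → Fin n → Fin n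
  shift c k = (c + toℕ k) mod n

  toℕ-shift : ∀ c k → toℕ (shift c k) ≡ (c + toℕ k) % n
  toℕ-shift c k = Fin.toℕ-fromℕ< _

  shift-shift : ∀ {c d} → c + d ≡ n → ∀ k → shift c (shift d k) ≡ k
  shift-shift {c} {d} c+d≡n k = Fin.toℕ-injective (begin
    toℕ (shift c (shift d k))  ≡⟨ toℕ-shift c (shift d k) ⟩
    (c + toℕ (shift d k)) % n  ≡⟨ cong (λ r → (c + r) % n) (toℕ-shift d k) ⟩
    (c + (d + toℕ k) % n) % n  ≡⟨ [m+k%n]%n≡[m+k]%n c (d + toℕ k) n ⟩
    (c + (d + toℕ k)) % n      ≡⟨ cong (_% n) (sym (ℕ.+-assoc c d (toℕ k))) ⟩
    (c + d + toℕ k) % n        ≡⟨ cong (λ m → (m + toℕ k) % n) c+d≡n ⟩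
    (n + toℕ k) % n            ≡⟨ [n+m]%n≡m (Fin.toℕ<n k) ⟩
    toℕ k                      ∎)
    where open ≡-Reasoning

module _ (i : Fin n) where
  private
    instance
      n≢0 : NonZero n
      n≢0 = Fin.nonZeroIndex i

    m : ℕ
    m = n ∸ toℕ i

    i+m≡n : toℕ i + m ≡ n
    i+m≡n = ℕ.m+[n∸m]≡n (ℕ.<⇒≤ (Fin.toℕ<n i))

    m+i≡n : m + toℕ i ≡ n
    m+i≡n = ℕ.m∸n+n≡m (ℕ.<⇒≤ (Fin.toℕ<n i))

    i+[m+k]≡n+k : ∀ k → toℕ i + (m + k) ≡ n + k
    i+[m+k]≡n+k k = trans (sym (ℕ.+-assoc (toℕ i) m k)) (cong (_+ k) i+m≡n)

  -- The outcome with word `Inc i`: spot k holds car i + k mod n, and car j stands in spot (n - i) +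
  -- j mod n.
  rotation : Permutation′ n
  rotation = permutation (shift (toℕ i)) (shift m) (shift-shift i+m≡n) (shift-shift m+i≡n)

  map-toℕ-Inc : List.map toℕ (Inc i) ≡ applyUpTo (toℕ i +_) m ++ upTo (toℕ i)
  map-toℕ-Inc = begin
    List.map toℕ (Inc i)
      ≡⟨ List.map-++ toℕ (List.drop (toℕ i) (allFin n)) (List.take (toℕ i) (allFin n)) ⟩
    List.map toℕ (List.drop (toℕ i) (allFin n)) ++ List.map toℕ (List.take (toℕ i) (allFin n))
      ≡⟨ cong₂ _++_ (List.drop-map (toℕ i) (allFin n)) (List.take-map (toℕ i) (allFin n)) ⟨
    List.drop (toℕ i) (List.map toℕ (allFin n)) ++ List.take (toℕ i) (List.map toℕ (allFin n))
      ≡⟨ cong (λ xs → List.drop (toℕ i) xs ++ List.take (toℕ i) xs)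
           (trans (List.map-tabulate id toℕ) (trans (tabulate-toℕ id n) (cong upTo (sym i+m≡n)))) ⟩
    List.drop (toℕ i) (upTo (toℕ i + m)) ++ List.take (toℕ i) (upTo (toℕ i + m))
      ≡⟨ cong₂ _++_ (drop-applyUpTo id (toℕ i) m) (take-applyUpTo id (toℕ i) m) ⟩
    applyUpTo (toℕ i +_) m ++ upTo (toℕ i) ∎
    where open ≡-Reasoning

  -- The word is split at m = n - i: the first m letters i + k stay below n, and the remaining i
  -- letters have wrapped around exactly once.
  word-rotation : word rotation ≡ Inc i
  word-rotation = List.map-injective Fin.toℕ-injective (begin
    List.map toℕ (List.tabulate (shift (toℕ i)))
      ≡⟨ List.map-tabulate (shift (toℕ i)) toℕ ⟩
    List.tabulate (toℕ ∘ shift (toℕ i))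
      ≡⟨ List.tabulate-cong (toℕ-shift (toℕ i)) ⟩
    List.tabulate (r ∘ toℕ)
      ≡⟨ tabulate-toℕ r n ⟩
    applyUpTo r n
      ≡⟨ cong (applyUpTo r) m+i≡n ⟨
    applyUpTo r (m + toℕ i)
      ≡⟨ applyUpTo-+ r m (toℕ i) ⟩
    applyUpTo r m ++ applyUpTo (r ∘ (m +_)) (toℕ i)
      ≡⟨ cong₂ _++_
           (applyUpTo-cong m λ {k} k<m →
             m<n⇒m%n≡m (subst (toℕ i + k <_) i+m≡n (ℕ.+-monoʳ-< (toℕ i) k<m)))
           (applyUpTo-cong (toℕ i) λ {k} k<i →
             trans (cong (_% n) (i+[m+k]≡n+k k)) ([n+m]%n≡m (ℕ.<-trans k<i (Fin.toℕ<n i)))) ⟩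
    applyUpTo (toℕ i +_) m ++ upTo (toℕ i)
      ≡⟨ map-toℕ-Inc ⟨
    List.map toℕ (Inc i) ∎)
    where
    open ≡-Reasoning
    r : ℕ → ℕ
    r k = (toℕ i + k) % n

  spot-≥ : ∀ j → i ≤ᶠ j → toℕ (rotation ⟨$⟩ˡ j) ≡ toℕ j ∸ toℕ i
  spot-≥ j i≤j = begin
    toℕ (shift m j)                         ≡⟨ toℕ-shift m j ⟩
    (m + toℕ j) % n                         ≡⟨ cong (λ x → (m + x) % n) (ℕ.m+[n∸m]≡n i≤j) ⟨
    (m + (toℕ i + (toℕ j ∸ toℕ i))) % n     ≡⟨ cong (_% n) (ℕ.+-assoc m (toℕ i) _) ⟨
    (m + toℕ i + (toℕ j ∸ toℕ i)) % n       ≡⟨ cong (λ x → (x + (toℕ j ∸ toℕ i)) % n) m+i≡n ⟩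
    (n + (toℕ j ∸ toℕ i)) % n               ≡⟨ [n+m]%n≡m (ℕ.≤-<-trans (ℕ.m∸n≤m (toℕ j) (toℕ i)) (Fin.toℕ<n j)) ⟩
    toℕ j ∸ toℕ i                           ∎
    where open ≡-Reasoning

  spot-< : ∀ j → j <ᶠ i → toℕ (rotation ⟨$⟩ˡ j) ≡ m + toℕ j
  spot-< j j<i = trans (toℕ-shift m j)
    (m<n⇒m%n≡m (subst (m + toℕ j <_) m+i≡n (ℕ.+-monoʳ-< m j<i)))

  module _ (d : Fin n → ℕ) (d≤ : ∀ j → d j ≤ toℕ j) (d≤∸ : ∀ j → i ≤ᶠ j → d j ≤ toℕ j ∸ toℕ i) where

    -- Subtracting `d j` from the spot of car j is therefore never truncated. For j < i the spot is
    -- m + j, so d j ≤ j suffices.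
    d≤spot : ∀ j → d j ≤ toℕ (rotation ⟨$⟩ˡ j)
    d≤spot j with i Fin.≤? j
    ... | yes i≤j = subst (d j ≤_) (sym (spot-≥ j i≤j)) (d≤∸ j i≤j)
    ... | no  i≰j = subst (d j ≤_) (sym (spot-< j (ℕ.≰⇒> i≰j)))
                      (ℕ.≤-trans (d≤ j) (ℕ.m≤n+m (toℕ j) m))

    -- A car preferring the spot `d j` places before its own drives past earlier cars only. If j ≥
    -- i, the spots before it hold i, ..., j-1. If j < i, the spots it passes lie in the second run,
    -- which holds 0, ..., j-1 before j.
    earlier-before : ∀ j l → toℕ (rotation ⟨$⟩ˡ j) ∸ d j ≤ toℕ l → l <ᶠ (rotation ⟨$⟩ˡ j) →
                     (rotation ⟨$⟩ʳ l) <ᶠ j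
    earlier-before j l lower upper with i Fin.≤? j
    ... | yes i≤j = begin-strict
      toℕ (shift (toℕ i) l)          ≡⟨ toℕ-shift (toℕ i) l ⟩
      -- Reduction modulo n never increases a number, so an upper bound needs no argument about
      -- wrapping.
      (toℕ i + toℕ l) % n            ≤⟨ m%n≤m (toℕ i + toℕ l) n ⟩
      toℕ i + toℕ l                  <⟨ ℕ.+-monoʳ-< (toℕ i) (subst (toℕ l <_) (spot-≥ j i≤j) upper) ⟩
      toℕ i + (toℕ j ∸ toℕ i)        ≡⟨ ℕ.m+[n∸m]≡n i≤j ⟩
      toℕ j                          ∎
      where open ℕ.≤-Reasoning
    ... | no  i≰j = begin-strict
      toℕ (shift (toℕ i) l)            ≡⟨ toℕ-shift (toℕ i) l ⟩
      (toℕ i + toℕ l) % n              ≡⟨ cong (λ x → (toℕ i + x) % n) m+x≡l ⟨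
      (toℕ i + (m + x)) % n            ≡⟨ cong (_% n) (i+[m+k]≡n+k x) ⟩
      (n + x) % n                      ≡⟨ [n+m]%n≡m (ℕ.<-trans x<j (Fin.toℕ<n j)) ⟩
      x                                <⟨ x<j ⟩
      toℕ j                            ∎
      where
      open ℕ.≤-Reasoning
      spot≡ = spot-< j (ℕ.≰⇒> i≰j)

      -- Since d j ≤ j, the preferred spot m + j - d j is not before m, where the second run begins.
      m≤l : m ≤ toℕ l
      m≤l = begin
        m                                ≤⟨ ℕ.m≤m+n m (toℕ j ∸ d j) ⟩
        m + (toℕ j ∸ d j)                ≡⟨ ℕ.+-∸-assoc m (d≤ j) ⟨
        m + toℕ j ∸ d j                  ≡⟨ cong (_∸ d j) spot≡ ⟨
        toℕ (rotation ⟨$⟩ˡ j) ∸ d j      ≤⟨ lower ⟩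
        toℕ l                            ∎

      x : ℕ
      x = toℕ l ∸ m

      m+x≡l : m + x ≡ toℕ l
      m+x≡l = ℕ.m+[n∸m]≡n m≤l

      x<j : x < toℕ j
      x<j = ℕ.+-cancelˡ-< m x (toℕ j) (subst (_< m + toℕ j) (sym m+x≡l) (subst (toℕ l <_) spot≡ upper))

-- The starting letter is read off from spot 0.
rotation-injective : (i j : Fin n) → rotation i ≈ rotation j → i ≡ j
rotation-injective i j eq = begin
  i                                       ≡⟨ inverseʳ (rotation i) ⟨
  rotation i ⟨$⟩ʳ (rotation i ⟨$⟩ˡ i)     ≡⟨ eq _ ⟩
  rotation j ⟨$⟩ʳ (rotation i ⟨$⟩ˡ i)     ≡⟨ cong (rotation j ⟨$⟩ʳ_) first ⟩
  rotation j ⟨$⟩ʳ (rotation j ⟨$⟩ˡ j)     ≡⟨ inverseʳ (rotation j) ⟩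
  j                                       ∎
  where
  open ≡-Reasoning
  spot-0 : ∀ i → toℕ (rotation i ⟨$⟩ˡ i) ≡ 0
  spot-0 i = trans (spot-≥ i i ℕ.≤-refl) (ℕ.n∸n≡0 (toℕ i))
  first : rotation i ⟨$⟩ˡ i ≡ rotation j ⟨$⟩ˡ j
  first = Fin.toℕ-injective (trans (spot-0 i) (sym (spot-0 j)))

-- The parking process

lookup-ext : {A : Set} {xs ys : Vec A n} → (∀ k → lookup xs k ≡ lookup ys k) → xs ≡ ys
lookup-ext eq =
  trans (sym (Vec.tabulate∘lookup _)) (trans (Vec.tabulate-cong eq) (Vec.tabulate∘lookup _))

head-filter⁺ : {P : Pred (Fin n) 0ℓ} (P? : Decidable P) {xs : List (Fin n)} →
               AllPairs _<ᶠ_ xs → ∀ {k} → k ∈ xs → P k → (∀ l → l <ᶠ k → ¬ P l) →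
               List.head (filter P? xs) ≡ just k
head-filter⁺ P? {x ∷ xs} (x< ∷ sorted) k∈ pk below with P? x
head-filter⁺ P? (x< ∷ sorted) (here refl) pk below | yes px = refl
head-filter⁺ P? (x< ∷ sorted) (there k∈)  pk below | yes px =
  contradiction px (below _ (All.lookup x< k∈))
head-filter⁺ P? (x< ∷ sorted) (here refl) pk below | no ¬px = contradiction pk ¬px
head-filter⁺ P? (x< ∷ sorted) (there k∈)  pk below | no ¬px = head-filter⁺ P? sorted k∈ pk below

module _ (p : Vec (Fin n) n) (π : Permutation′ n)
         (≤spot : ∀ j → lookup p j ≤ᶠ (π ⟨$⟩ˡ j))
         (passed : ∀ j l → lookup p j ≤ᶠ l → l <ᶠ (π ⟨$⟩ˡ j) → (π ⟨$⟩ʳ l) <ᶠ j) where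

  -- The hypothesis on `s` is the loop invariant: a spot is empty if its car under π is still to
  -- come, and otherwise already holds that car, which precedes every car still to come.
  parkAll⁺ : ∀ {js} s → AllPairs _<ᶠ_ js →
             (∀ k → (π ⟨$⟩ʳ k ∈ js × lookup s k ≡ nothing) ⊎
                    (All ((π ⟨$⟩ʳ k) <ᶠ_) js × lookup s k ≡ just (π ⟨$⟩ʳ k))) →
             parkAll p js s ≡ just (Vec.tabulate (λ k → just (π ⟨$⟩ʳ k)))
  parkAll⁺ {[]} s [] state = cong just (lookup-ext λ k → trans (full k) (sym (Vec.lookup∘tabulate _ k)))
    where
    full : ∀ k → lookup s k ≡ just (π ⟨$⟩ʳ k)
    full k with state k
    ... | inj₁ (() , _)
    ... | inj₂ (_ , eq) = eq
  parkAll⁺ {j ∷ js} s (j< ∷ sorted) state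
    = trans (cong (_>>= λ k → parkAll p js (s [ k ]≔ just j)) found)
        (parkAll⁺ (s [ π ⟨$⟩ˡ j ]≔ just j) sorted state′)
    where
    free : lookup s (π ⟨$⟩ˡ j) ≡ nothing
    free with state (π ⟨$⟩ˡ j)
    ... | inj₁ (_ , eq) = eq
    ... | inj₂ (lt ∷ _ , _) = contradiction (cong toℕ (inverseʳ π)) (ℕ.<⇒≢ lt)

    occupied : ∀ l → l <ᶠ (π ⟨$⟩ˡ j) → ¬ (lookup p j ≤ᶠ l × lookup s l ≡ nothing)
    occupied l l< (q≤l , l-free) with state l
    ... | inj₂ (_ , eq) with () ← trans (sym l-free) eq
    -- The car destined for an empty spot l is j or a later one, whereas `passed` requires an
    -- earlier one.
    ... | inj₁ (πl∈ , _) = late πl∈ (passed j l q≤l l<)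
      where
      late : ∀ {c} → c ∈ j ∷ js → ¬ (c <ᶠ j)
      late (here refl) = ℕ.<-irrefl refl
      late (there c∈)  = ℕ.<-asym (All.lookup j< c∈)

    found : firstFree s (lookup p j) ≡ just (π ⟨$⟩ˡ j)
    found = head-filter⁺ (λ k → (lookup p j Fin.≤? k) ×-dec free? s k) (allFin-sorted n)
              (∈-allFin (π ⟨$⟩ˡ j)) (≤spot j , free) occupied

    state′ : ∀ k → (π ⟨$⟩ʳ k ∈ js × lookup (s [ π ⟨$⟩ˡ j ]≔ just j) k ≡ nothing) ⊎
                   (All ((π ⟨$⟩ʳ k) <ᶠ_) js ×
                    lookup (s [ π ⟨$⟩ˡ j ]≔ just j) k ≡ just (π ⟨$⟩ʳ k))
    state′ k with k Fin.≟ (π ⟨$⟩ˡ j)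
    ... | yes refl = inj₂ (subst (λ c → All (c <ᶠ_) js) (sym (inverseʳ π)) j< ,
                           trans (Vec.lookup∘updateAt k s) (cong just (sym (inverseʳ π))))
    ... | no k≢ with state k | Vec.lookup∘updateAt′ k (π ⟨$⟩ˡ j) {f = λ _ → just j} k≢ s
    ...   | inj₁ (here refl , _)   | _   = contradiction (sym (inverseˡ π)) k≢
    ...   | inj₁ (there πk∈ , eq)  | old = inj₁ (πk∈ , trans old eq)
    ...   | inj₂ (_ ∷ πk< , eq)    | old = inj₂ (πk< , trans old eq)

  -- Converse to `spotOf`: the two properties extracted there force the process to end in π.
  park⁺ : park p ≡ just (Vec.tabulate (λ k → just (π ⟨$⟩ʳ k)))
  park⁺ = parkAll⁺ (Vec.replicate n nothing) (allFin-sorted n)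
    λ k → inj₁ (∈-allFin (π ⟨$⟩ʳ k) , Vec.lookup-replicate k nothing)

-- The map Ψ

module _ (p : CycPF n) where
  open CycPF p

  outcome≈rotation : outcome ≈ rotation start
  outcome≈rotation = tabulate-injective (trans cyclic (sym (word-rotation start)))

  -- A displacement is at most the spot number, and car j ≥ `start` stands in spot j - `start`.
  disp≤∸ : ∀ j → start ≤ᶠ j → disp p j ≤ toℕ j ∸ toℕ start
  disp≤∸ j i≤j = subst (disp p j ≤_)
    (trans (cong toℕ (≈-from {σ = outcome} {rotation start} outcome≈rotation j)) (spot-≥ start j i≤j))
    (ℕ.m∸n≤m (toℕ (outcome ⟨$⟩ˡ j)) (toℕ (lookup pref j)))

  pref≡spot∸disp : ∀ j → toℕ (lookup pref j) ≡ toℕ (outcome ⟨$⟩ˡ j) ∸ disp p j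
  pref≡spot∸disp j = sym (ℕ.m∸[m∸n]≡n (proj₁ (spotOf parking j)))

  invSeq-Ψ : InvSeq (Perm (Ψ p)) ≗ disp p
  invSeq-Ψ = proj₁ (proj₂ (invSeq-bijective (disp p) (displacement-bounded parking)))

  start∈block : ⟦ Comp.block (Ψ p) ⟧ start
  start∈block = proj₂ (proj₁ (proj₂ (componentOf (Perm (Ψ p)) start)))

  -- The bound `disp≤∸` on inversion numbers yields a cut at `start`. Hence `start` can be recovered
  -- from the component.
  block-start : proj₁ (Comp.block (Ψ p)) ≡ start
  block-start = component-start (Perm (Ψ p)) (Comp.isComponent (Ψ p)) start∈block
    (inv≤⇒cut (Perm (Ψ p)) (toℕ start)
      λ j i≤j → subst (_≤ toℕ j ∸ toℕ start) (sym (invSeq-Ψ j)) (disp≤∸ j i≤j))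

  -- The inversion sequence determines the permutation, and only one of its components contains
  -- `start`. Both congruence and surjectivity of `Ψ` rest on this.
  Ψ-unique : (c : Comp n) → InvSeq (Perm c) ≗ disp p → ⟦ Comp.block c ⟧ start → Ψ p ≈ᴷ c
  Ψ-unique c inv≗ start∈ =
    perm≈ , proj₂ (proj₂ (componentOf (Perm (Ψ p)) start))
      (isComponent-cong {σ = Perm c} {Perm (Ψ p)} (≈-sym {σ = Perm (Ψ p)} {Perm c} perm≈)
        (Comp.isComponent c) , start∈)
    where
    perm≈ : Perm (Ψ p) ≈ Perm c
    perm≈ = invSeq-injective (Perm (Ψ p)) (Perm c) λ j → trans (invSeq-Ψ j) (sym (inv≗ j))

-- The process is deterministic, so the stored outcome depends on the preference alone.
outcome-cong : (p q : CycPF n) → p ≈ᶜ q → CycPF.outcome p ≈ CycPF.outcome q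
outcome-cong p q eq k = just-injective (begin
  just (P.outcome ⟨$⟩ʳ k)                                  ≡⟨ Vec.lookup∘tabulate _ k ⟨
  lookup (Vec.tabulate (λ k → just (P.outcome ⟨$⟩ʳ k))) k  ≡⟨ cong (λ t → lookup t k) final ⟩
  lookup (Vec.tabulate (λ k → just (Q.outcome ⟨$⟩ʳ k))) k  ≡⟨ Vec.lookup∘tabulate _ k ⟩
  just (Q.outcome ⟨$⟩ʳ k)                                  ∎)
  where
  open ≡-Reasoning
  module P = CycPF p
  module Q = CycPF q
  final = just-injective (trans (sym P.parks) (trans (cong park eq) Q.parks))

start-cong : (p q : CycPF n) → p ≈ᶜ q → CycPF.start p ≡ CycPF.start q
start-cong p q eq = rotation-injective (CycPF.start p) (CycPF.start q) λ k →
  trans (sym (outcome≈rotation p k)) (trans (outcome-cong p q eq k) (outcome≈rotation q k))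

disp-cong : (p q : CycPF n) → p ≈ᶜ q → disp p ≗ disp q
disp-cong p q eq j = cong₂ (λ s t → toℕ s ∸ toℕ t)
  (≈-from {σ = CycPF.outcome p} {CycPF.outcome q} (outcome-cong p q eq) j)
  (cong (λ v → lookup v j) eq)

Ψ-cong : (p q : CycPF n) → p ≈ᶜ q → Ψ p ≈ᴷ Ψ q
Ψ-cong p q eq = Ψ-unique p (Ψ q)
  (λ j → trans (invSeq-Ψ q j) (sym (disp-cong p q eq j)))
  (subst ⟦ Comp.block (Ψ q) ⟧ (sym (start-cong p q eq)) (start∈block q))

-- The lower end of the block gives `start`, hence the outcome. The inversion numbers give the
-- displacements. The preference of each car is its spot minus its displacement.
Ψ-injective : (p q : CycPF n) → Ψ p ≈ᴷ Ψ q → p ≈ᶜ q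
Ψ-injective p q (perm≈ , block≡) = lookup-ext λ j → Fin.toℕ-injective (begin
  toℕ (lookup P.pref j)                  ≡⟨ pref≡spot∸disp p j ⟩
  toℕ (P.outcome ⟨$⟩ˡ j) ∸ disp p j      ≡⟨ cong₂ (λ s d → toℕ s ∸ d)
                                              (≈-from {σ = P.outcome} {Q.outcome} outcome≈ j)
                                              (disp≡ j) ⟩
  toℕ (Q.outcome ⟨$⟩ˡ j) ∸ disp q j      ≡⟨ pref≡spot∸disp q j ⟨
  toℕ (lookup Q.pref j)                  ∎)
  where
  open ≡-Reasoning
  module P = CycPF p
  module Q = CycPF q

  start≡ : P.start ≡ Q.start
  start≡ = trans (sym (block-start p)) (trans (cong proj₁ block≡) (block-start q))

  outcome≈ : P.outcome ≈ Q.outcome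
  outcome≈ k = trans (outcome≈rotation p k)
    (trans (cong (λ i → rotation i ⟨$⟩ʳ k) start≡) (sym (outcome≈rotation q k)))

  disp≡ : disp p ≗ disp q
  disp≡ j = trans (sym (invSeq-Ψ p j))
    (trans (inv-cong {σ = Perm (Ψ p)} {Perm (Ψ q)} perm≈ j) (invSeq-Ψ q j))

-- The inverse of Ψ

module _ (c : Comp n) where
  private
    σ = Perm c
    i = proj₁ (Comp.block c)
    π = rotation i

    cuts = block⁻ σ (proj₁ (Comp.isComponent c))

    inv≤∸ : ∀ j → i ≤ᶠ j → inv j σ ≤ toℕ j ∸ toℕ i
    inv≤∸ = cut⇒inv≤ σ (proj₁ (proj₂ cuts))

    pref< : ∀ j → toℕ (π ⟨$⟩ˡ j) ∸ inv j σ < n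
    pref< j = ℕ.≤-<-trans (ℕ.m∸n≤m _ (inv j σ)) (Fin.toℕ<n (π ⟨$⟩ˡ j))

    p : Vec (Fin n) n
    -- Car j prefers the spot `inv j σ` places before the one it occupies in the rotation starting
    -- at the lower end i.
    p = Vec.tabulate (λ j → fromℕ< (pref< j))

    toℕ-p : ∀ j → toℕ (lookup p j) ≡ toℕ (π ⟨$⟩ˡ j) ∸ inv j σ
    toℕ-p j = trans (cong toℕ (Vec.lookup∘tabulate _ j)) (Fin.toℕ-fromℕ< (pref< j))

  Ψ⁻¹ : CycPF n
  Ψ⁻¹ = record
    { parking = record
      { pref    = p
      ; outcome = π
      ; parks   = park⁺ p π
          (λ j → subst (_≤ toℕ (π ⟨$⟩ˡ j)) (sym (toℕ-p j)) (ℕ.m∸n≤m _ (inv j σ)))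
          (λ j l p≤l → earlier-before i (λ j → inv j σ) (inv≤ σ) inv≤∸ j l
                         (subst (_≤ toℕ l) (toℕ-p j) p≤l))
      }
    ; start  = i
    ; cyclic = word-rotation i
    }

  disp-Ψ⁻¹ : InvSeq σ ≗ disp Ψ⁻¹
  disp-Ψ⁻¹ j = sym (trans (cong (toℕ (π ⟨$⟩ˡ j) ∸_) (toℕ-p j))
    (ℕ.m∸[m∸n]≡n (d≤spot i (λ j → inv j σ) (inv≤ σ) inv≤∸ j)))

  Ψ-Ψ⁻¹ : Ψ Ψ⁻¹ ≈ᴷ c
  -- The block is nonempty, so it contains its lower end, which is the `start` of `Ψ⁻¹`.
  Ψ-Ψ⁻¹ = Ψ-unique Ψ⁻¹ c disp-Ψ⁻¹ (ℕ.≤-refl , proj₁ cuts)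

≈ᴷ-trans : {b c d : Comp n} → b ≈ᴷ c → c ≈ᴷ d → b ≈ᴷ d
≈ᴷ-trans {b = b} {c} {d} (σ≈τ , B≡C) (τ≈υ , C≡D) =
  ≈-trans {σ = Perm b} {Perm c} {Perm d} σ≈τ τ≈υ , trans B≡C C≡D

theorem3p7 : ∀ (n : ℕ) →
    IsBijection (_≈ᶜ_ {n}) (_≈ᴷ_ {n}) Ψ ×
    (∀ (p : CycPF n) (j : Fin n) → disp p j ≡ inv j (Perm (Ψ p)))
theorem3p7 n = record
  { isInjection = record
    { isCongruent = record
      { cong = λ {p} {q} → Ψ-cong p q
      ; isEquivalence₁ = record { refl = refl ; sym = sym ; trans = trans }
      ; isEquivalence₂ = record
        { refl  = (λ _ → refl) , refl
        ; sym   = λ {c} {d} (σ≈τ , B≡C) → ≈-sym {σ = Perm c} {Perm d} σ≈τ , sym B≡C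
        ; trans = λ {b} {c} {d} → ≈ᴷ-trans {b = b} {c} {d}
        }
      }
    ; injective = λ {p} {q} → Ψ-injective p q
    }
  -- Surjectivity between setoids asks that every p equivalent to the chosen preimage map to c,
  -- hence the use of `Ψ-cong`.
  ; surjective = λ c → Ψ⁻¹ c , λ {p} p≈ →
      ≈ᴷ-trans {b = Ψ p} {Ψ (Ψ⁻¹ c)} {c} (Ψ-cong p (Ψ⁻¹ c) p≈) (Ψ-Ψ⁻¹ c)
  } , λ p j → sym (invSeq-Ψ p j)
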